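{- Let $\mathbb{M} = \langle W, \{\sim_i\}_{i \in G}, \{\leq_{i,w}\}_{i \in G}^{w \in W}, V\rangle$ and $\mathbb{M}' = \langle W', \{\sim'_i\}_{i \in G}, \{\leq'_{i,w'}\}_{i \in G}^{w' \in W'}, V'\rangle$ be epistemic plausibility models and let $Z \subseteq W \times W'$ be a relation. 1. If $Z$ is a $[>]$-bisimulation, then for all $\varphi\in\mathcal{L}([>])$ and all $(w,w')\in Z$: $\mathbb{M},w\models\varphi\Leftrightarrow\mathbb{M}',w'\models\varphi$. 2. If $Z$ is a $\{K,[>]\}$-bisimulation, then for all $\varphi\in\mathcal{L}(K,[>])$ and all $(w,w')\in Z$: $\mathbb{M},w\models\varphi\Leftrightarrow\mathbb{M}',w'\models\varphi$. 3. If $\mathbb{M}$ and $\mathbb{M}'$ are uniform and $Z$ is a $\{K,[>]\}$-bisimulation, then for all $\varphi\in\mathcal{L}(K,B^c)$ and all $(w,w')\in Z$: $\mathbb{M},w\models\varphi\Leftrightarrow\mathbb{M}',w'\models\varphi$. 4. If $\mathbb{M}$ and $\mathbb{M}'$ are uniform and image-finite, then for all states $w\in W$ and $w'\in W'$: if $w$ and $w'$ are $\{K,[>]\}$-bisimilar, then they are $\{K,B^c\}$-bisimilar as well.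
   Context: Fix a non-empty set $G$ of agents and a countably infinite set $Prop$ of proposition letters. Models. An epistemic plausibility model is a structure $\mathbb{M} = \langle W, \{\sim_i\}_{i \in G}, \{\leq_{i,w}\}_{i \in G}^{w \in W}, V\rangle$ where $W$ is a non-empty set of states, each $\sim_i \subseteq W\times W$ is an equivalence relation, each $\leq_{i,w} \subseteq W \times W$ is a well-founded pre-order, and $V : Prop \to \wp(W)$. For $X \subseteq W$, $\mathrm{Min}_{\leq_{i,w}}(X) := \{x \in X \mid \forall y \in X: y \leq_{i,w} x \Rightarrow x \leq_{i,w} y\}$. A well-founded pre-order is a reflexive transitive relation (not necessarily total) such that $\mathrm{Min}_{\leq_{i,w}}(X) \neq \emptyset$ for every non-empty $X \subseteq W$. Write $[w]_{\sim_i} := \{v \in W \mid w \sim_i v\}$, and $x<_{i,w}y$ iff $x\leq_{i,w}y$ and not $y\leq_{i,w}x$. The model is uniform iff for all $i\in G$ and $w,v\in W$: if $w\sim_i v$ then $\leq_{i,w}=\leq_{i,v}$. It is image-finite if $[w]_{\sim_i}$ is finite for all $i\in G$ and $w\in W$. Languages and semantics. Each language is built from proposition letters $p\in Prop$ using $\neg$, $\wedge$ and the listed operators (for all $i\in G$): $\mathcal{L}([>])$ has $[>_i]$; $\mathcal{L}(K,[>])$ has $K_i$ and $[>_i]$; $\mathcal{L}(K,B^c)$ has $K_i$ and $B_i^\alpha\varphi$ ($\alpha,\varphi$ both formulas of the language). Proposition letters (via $V$) and Booleans are interpreted as usual; $[\![\alpha]\!]^{\mathbb{M}} := \{w \in W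 \mid \mathbb{M},w\models\alpha\}$; $\mathbb{M},w \models K_i\varphi$ iff $\forall v \in [w]_{\sim_i}: \mathbb{M},v\models\varphi$; $\mathbb{M},w \models B_i^\alpha\varphi$ iff $\forall v \in \mathrm{Min}_{\leq_{i,w}}([\![\alpha]\!]^{\mathbb{M}} \cap [w]_{\sim_i}): \mathbb{M},v\models\varphi$; $\mathbb{M},w \models [>_i]\varphi$ iff $\forall v \in [w]_{\sim_i}: v <_{i,w} w \Rightarrow \mathbb{M},v\models\varphi$. Bisimulations. Let $Z\subseteq W\times W'$. In each case the "atoms" clause is required: if $(w,w')\in Z$ then for all $p\in Prop$, $w\in V(p)\Leftrightarrow w'\in V'(p)$. In addition, for all $i\in G$: - $Z$ is a $K$-bisimulation iff: if $(w,w')\in Z$ and $w\sim_i v$, then there is $v'\in W'$ with $(v,v')\in Z$ and $w'\sim'_i v'$; and if $(w,w')\in Z$ and $w'\sim'_i v'$, then there is $v \in W$ with $(v,v')\in Z$ and $w\sim_i v$. - $Z$ is a $[>]$-bisimulation iff: if $(w,w')\in Z$, $w\sim_i v$ and $v<_{i,w} w$, then there is $v'\in W'$ with $(v,v')\in Z$, $w'\sim'_i v'$ and $v'<'_{i,w'}w'$; and if $(w,w')\in Z$, $w'\sim'_i v'$ and $v'<'_{i,w'}w'$, then there is $v\in W$ with $(v,v')\in Z$, $w\sim_i v$ and $v<_{i,w}w$. - $Z$ is a $\{K,[>]\}$-bisimulation iff it is both a $K$-bisimulation and a $[>]$-bisimulation. - $Z$ is a $\{K,B^c\}$-bisimulation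 iff it is a $K$-bisimulation and for all formulas $\alpha\in\mathcal{L}(K,B^c)$: if $(w,w')\in Z$ and $v\in \mathrm{Min}_{\leq_{i,w}}([\![\alpha]\!]^{\mathbb{M}}\cap[w]_{\sim_i})$, then there is $v'\in W'$ with $(v,v')\in Z$ and $v'\in \mathrm{Min}_{\leq'_{i,w'}}([\![\alpha]\!]^{\mathbb{M}'}\cap[w']_{\sim'_i})$; and if $(w,w')\in Z$ and $v'\in \mathrm{Min}_{\leq'_{i,w'}}([\![\alpha]\!]^{\mathbb{M}'}\cap[w']_{\sim'_i})$, then there is $v\in W$ with $(v,v')\in Z$ and $v\in \mathrm{Min}_{\leq_{i,w}}([\![\alpha]\!]^{\mathbb{M}}\cap[w]_{\sim_i})$. States $w\in W$, $w'\in W'$ are bisimilar (of a given type) if there is a bisimulation $Z$ of that type with $(w,w')\in Z$. -}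

module Defs where

open import Data.List.Base using (List)
open import Data.List.Membership.Propositional using () renaming (_∈_ to _∈ˡ_)
open import Data.Product.Base using (Σ-syntax; ∃-syntax; _×_)
open import Function.Bundles using (_⇔_)
open import Level using (Level; suc; _⊔_)
open import Relation.Binary.Core using (Rel; REL) renaming (_⇔_ to _⇔ʳ_)
open import Relation.Binary.Structures using (IsEquivalence; IsPreorder)
open import Relation.Binary.PropositionalEquality using (_≡_)
open import Relation.Nullary.Negation using (¬_)
open import Relation.Unary using (Pred; _∈_; _∩_; Satisfiable)

private
  variable
    g p ℓ : Level
    G : Set g
    Letter : Set p

Min : {W : Set ℓ} → Rel W ℓ → Pred W ℓ → Pred W ℓ
Min _≤_ X x = x ∈ X × (∀ y → y ∈ X → y ≤ x → x ≤ y)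

-- The subsets of W : Set ℓ are the predicates W → Set ℓ; truth sets of
-- formulas are among them.
record IsWellFoundedPreorder {W : Set ℓ} (_≤_ : Rel W ℓ) : Set (suc ℓ) where
  field
    isPreorder   : IsPreorder _≡_ _≤_
    min-nonempty : (X : Pred W ℓ) → Satisfiable X → Satisfiable (Min _≤_ X)

record Model (G : Set g) (Letter : Set p) (ℓ : Level) : Set (g ⊔ p ⊔ suc ℓ) where
  field
    W             : Set ℓ
    inhabitant    : W
    ∼             : G → Rel W ℓ
    ∼-equivalence : ∀ i → IsEquivalence (∼ i)
    ≤             : G → W → Rel W ℓ
    ≤-wellFounded : ∀ i w → IsWellFoundedPreorder (≤ i w)
    V             : Letter → Pred W ℓ

  Class : G → W → Pred W ℓ
  Class i w v = ∼ i w v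

  < : G → W → Rel W ℓ
  < i w x y = ≤ i w x y × ¬ ≤ i w y x

open Model using (W; ∼; ≤; V; Class; <)

Uniform : {G : Set g} {Letter : Set p} → Model G Letter ℓ → Set (g ⊔ ℓ)
Uniform M = ∀ i w v → ∼ M i w v → ≤ M i w ⇔ʳ ≤ M i v

ImageFinite : {G : Set g} {Letter : Set p} → Model G Letter ℓ → Set (g ⊔ ℓ)
ImageFinite M =
  ∀ i w → Σ[ xs ∈ List (W M) ] (∀ v → v ∈ˡ xs ⇔ v ∈ Class M i w)

data Formula[>] (G : Set g) (Letter : Set p) : Set (g ⊔ p) where
  atom : Letter → Formula[>] G Letter
  neg  : Formula[>] G Letter → Formula[>] G Letter
  _∧_  : Formula[>] G Letter → Formula[>] G Letter → Formula[>] G Letter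
  [>]  : G → Formula[>] G Letter → Formula[>] G Letter

data FormulaK[>] (G : Set g) (Letter : Set p) : Set (g ⊔ p) where
  atom : Letter → FormulaK[>] G Letter
  neg  : FormulaK[>] G Letter → FormulaK[>] G Letter
  _∧_  : FormulaK[>] G Letter → FormulaK[>] G Letter → FormulaK[>] G Letter
  K    : G → FormulaK[>] G Letter → FormulaK[>] G Letter
  [>]  : G → FormulaK[>] G Letter → FormulaK[>] G Letter

-- B i α φ is agent i's belief in φ conditional on α.
data FormulaKBᶜ (G : Set g) (Letter : Set p) : Set (g ⊔ p) where
  atom : Letter → FormulaKBᶜ G Letter
  neg  : FormulaKBᶜ G Letter → FormulaKBᶜ G Letter
  _∧_  : FormulaKBᶜ G Letter → FormulaKBᶜ G Letter → FormulaKBᶜ G Letter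
  K    : G → FormulaKBᶜ G Letter → FormulaKBᶜ G Letter
  B    : G → FormulaKBᶜ G Letter → FormulaKBᶜ G Letter → FormulaKBᶜ G Letter

infix 4 _,_⊨[>]_ _,_⊨K[>]_ _,_⊨KBᶜ_

_,_⊨[>]_ : (M : Model G Letter ℓ) → W M → Formula[>] G Letter → Set ℓ
M , w ⊨[>] atom q  = w ∈ V M q
M , w ⊨[>] neg φ   = ¬ (M , w ⊨[>] φ)
M , w ⊨[>] (φ ∧ ψ) = (M , w ⊨[>] φ) × (M , w ⊨[>] ψ)
M , w ⊨[>] [>] i φ = ∀ v → v ∈ Class M i w → < M i w v w → M , v ⊨[>] φ

_,_⊨K[>]_ : (M : Model G Letter ℓ) → W M → FormulaK[>] G Letter → Set ℓ
M , w ⊨K[>] atom q  = w ∈ V M q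
M , w ⊨K[>] neg φ   = ¬ (M , w ⊨K[>] φ)
M , w ⊨K[>] (φ ∧ ψ) = (M , w ⊨K[>] φ) × (M , w ⊨K[>] ψ)
M , w ⊨K[>] K i φ   = ∀ v → v ∈ Class M i w → M , v ⊨K[>] φ
M , w ⊨K[>] [>] i φ = ∀ v → v ∈ Class M i w → < M i w v w → M , v ⊨K[>] φ

mutual
  _,_⊨KBᶜ_ : (M : Model G Letter ℓ) → W M → FormulaKBᶜ G Letter → Set ℓ
  M , w ⊨KBᶜ atom q  = w ∈ V M q
  M , w ⊨KBᶜ neg φ   = ¬ (M , w ⊨KBᶜ φ)
  M , w ⊨KBᶜ (φ ∧ ψ) = (M , w ⊨KBᶜ φ) × (M , w ⊨KBᶜ ψ)
  M , w ⊨KBᶜ K i φ   = ∀ v → v ∈ Class M i w → M , v ⊨KBᶜ φ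
  M , w ⊨KBᶜ B i α φ =
    ∀ v → v ∈ Min (≤ M i w) (⟦ α ⟧ M ∩ Class M i w) → M , v ⊨KBᶜ φ

  ⟦_⟧ : FormulaKBᶜ G Letter → (M : Model G Letter ℓ) → Pred (W M) ℓ
  ⟦ α ⟧ M w = M , w ⊨KBᶜ α

module _ {G : Set g} {Letter : Set p} (M M′ : Model G Letter ℓ) where

  AtomsAgree : REL (W M) (W M′) ℓ → Set (p ⊔ ℓ)
  AtomsAgree Z = ∀ {w w′} → Z w w′ → ∀ q → w ∈ V M q ⇔ w′ ∈ V M′ q

  record IsKBisimulation (Z : REL (W M) (W M′) ℓ) : Set (g ⊔ p ⊔ ℓ) where
    field
      atoms : AtomsAgree Z
      forth : ∀ i {w w′ v} → Z w w′ → ∼ M i w v →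
              ∃[ v′ ] Z v v′ × ∼ M′ i w′ v′
      back  : ∀ i {w w′ v′} → Z w w′ → ∼ M′ i w′ v′ →
              ∃[ v ] Z v v′ × ∼ M i w v

  record Is[>]Bisimulation (Z : REL (W M) (W M′) ℓ) : Set (g ⊔ p ⊔ ℓ) where
    field
      atoms : AtomsAgree Z
      forth : ∀ i {w w′ v} → Z w w′ → ∼ M i w v → < M i w v w →
              ∃[ v′ ] Z v v′ × ∼ M′ i w′ v′ × < M′ i w′ v′ w′
      back  : ∀ i {w w′ v′} → Z w w′ → ∼ M′ i w′ v′ → < M′ i w′ v′ w′ →
              ∃[ v ] Z v v′ × ∼ M i w v × < M i w v w

  IsK[>]Bisimulation : REL (W M) (W M′) ℓ → Set (g ⊔ p ⊔ ℓ)
  IsK[>]Bisimulation Z = IsKBisimulation Z × Is[>]Bisimulation Z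

  record IsKBᶜBisimulation (Z : REL (W M) (W M′) ℓ) : Set (g ⊔ p ⊔ ℓ) where
    field
      isKBisimulation : IsKBisimulation Z
      forth : ∀ i (α : FormulaKBᶜ G Letter) {w w′ v} → Z w w′ →
              v ∈ Min (≤ M i w) (⟦ α ⟧ M ∩ Class M i w) →
              ∃[ v′ ] Z v v′ × v′ ∈ Min (≤ M′ i w′) (⟦ α ⟧ M′ ∩ Class M′ i w′)
      back  : ∀ i (α : FormulaKBᶜ G Letter) {w w′ v′} → Z w w′ →
              v′ ∈ Min (≤ M′ i w′) (⟦ α ⟧ M′ ∩ Class M′ i w′) →
              ∃[ v ] Z v v′ × v ∈ Min (≤ M i w) (⟦ α ⟧ M ∩ Class M i w)

  K[>]Bisimilar : W M → W M′ → Set (g ⊔ p ⊔ suc ℓ)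
  K[>]Bisimilar w w′ =
    Σ[ Z ∈ REL (W M) (W M′) ℓ ] IsK[>]Bisimulation Z × Z w w′

  KBᶜBisimilar : W M → W M′ → Set (g ⊔ p ⊔ suc ℓ)
  KBᶜBisimilar w w′ =
    Σ[ Z ∈ REL (W M) (W M′) ℓ ] IsKBᶜBisimulation Z × Z w w′

{-# OPTIONS --safe #-}

-- The idea for conditional belief: if Z v v′ and v is minimal in X, then v′ is
-- minimal in the Z-corresponding X′.  A y′ in X′ strictly below v′ would, by
-- uniformity, be below v′ in the order indexed by v′ itself, so the
-- [>]-bisimulation yields a y in X strictly below v.  Hence every
-- {K,[>]}-bisimulation between uniform models is itself a
-- {K,Bᶜ}-bisimulation.
module Submission where

open import Axiom.ExcludedMiddle using (ExcludedMiddle)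
open import Data.Nat.Base using (ℕ)
open import Data.Product.Base using (_×_; _,_; ∃-syntax; curry; uncurry; proj₁)
open import Data.Product.Function.NonDependent.Propositional using (_×-⇔_)
open import Function.Base using (flip; _∘_)
open import Function.Bundles using (_⇔_; _↔_; mk⇔; module Equivalence)
open import Function.Construct.Symmetry using (⇔-sym)
open import Function.Related.TypeIsomorphisms using (¬-cong-⇔)
open import Level using (Level)
open import Relation.Binary.Core using (REL)
open import Relation.Binary.Structures using (IsEquivalence)
open import Relation.Nullary.Decidable using (decidable-stable)
open import Relation.Unary using (Pred; _∈_; _∩_)
open import Defs
open Model using (W; ∼; ∼-equivalence; ≤; <; Class)
open Equivalence using (to; from)

private
  variable
    g p ℓ : Level
    G : Set g
    Letter : Set p

module _ {A A′ : Set ℓ} {Z : REL A A′ ℓ} {P : Pred A ℓ} {P′ : Pred A′ ℓ} where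

  -- A successor on either side is matched by a `Z`-related one on the other, where the box applies,
  -- and the body is carried along `Z`; so each direction uses the opposite clause. Taking `R` and
  -- `R′` as bare predicates covers both information cells and sets of minimal states.
  box-cong : {R : Pred A ℓ} {R′ : Pred A′ ℓ} →
    (∀ {v} → R v → ∃[ v′ ] Z v v′ × R′ v′) →
    (∀ {v′} → R′ v′ → ∃[ v ] Z v v′ × R v) →
    (∀ v v′ → Z v v′ → P v ⇔ P′ v′) →
    (∀ v → R v → P v) ⇔ (∀ v′ → R′ v′ → P′ v′)
  box-cong forth back P⇔P′ = mk⇔
    (λ □P v′ r′ → let (v , z , r) = back r′ in to (P⇔P′ v v′ z) (□P v r))
    (λ □P′ v r → let (v′ , z , r′) = forth r in from (P⇔P′ v v′ z) (□P′ v′ r′))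

  box-cong₂ : {R S : Pred A ℓ} {R′ S′ : Pred A′ ℓ} →
    (∀ {v} → R v → S v → ∃[ v′ ] Z v v′ × R′ v′ × S′ v′) →
    (∀ {v′} → R′ v′ → S′ v′ → ∃[ v ] Z v v′ × R v × S v) →
    (∀ v v′ → Z v v′ → P v ⇔ P′ v′) →
    (∀ v → R v → S v → P v) ⇔ (∀ v′ → R′ v′ → S′ v′ → P′ v′)
  box-cong₂ {R} {S} {R′} {S′} forth back P⇔P′ = mk⇔
    (λ □P v′ → curry (to box (λ v → uncurry (□P v)) v′))
    (λ □P′ v → curry (from box (λ v′ → uncurry (□P′ v′)) v))
    where
    box : (∀ v → (R ∩ S) v → P v) ⇔ (∀ v′ → (R′ ∩ S′) v′ → P′ v′)
    box = box-cong (uncurry forth) (uncurry back) P⇔P′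

module _ {M M′ : Model G Letter ℓ} {Z : REL (W M) (W M′) ℓ} where

  [>]-invariance : Is[>]Bisimulation M M′ Z →
    ∀ φ w w′ → Z w w′ → (M , w ⊨[>] φ) ⇔ (M′ , w′ ⊨[>] φ)
  [>]-invariance bis = go
    where
    open Is[>]Bisimulation bis
    go : ∀ φ w w′ → Z w w′ → (M , w ⊨[>] φ) ⇔ (M′ , w′ ⊨[>] φ)
    go (atom q)  w w′ z = atoms z q
    go (neg φ)   w w′ z = ¬-cong-⇔ (go φ w w′ z)
    go (φ ∧ ψ)   w w′ z = go φ w w′ z ×-⇔ go ψ w w′ z
    go ([>] i φ) w w′ z = box-cong₂ (forth i z) (back i z) (go φ)

  K[>]-invariance : IsK[>]Bisimulation M M′ Z →
    ∀ φ w w′ → Z w w′ → (M , w ⊨K[>] φ) ⇔ (M′ , w′ ⊨K[>] φ)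
  K[>]-invariance (bisK , bis[>]) = go
    where
    module K-bis = IsKBisimulation bisK
    module [>]-bis = Is[>]Bisimulation bis[>]
    go : ∀ φ w w′ → Z w w′ → (M , w ⊨K[>] φ) ⇔ (M′ , w′ ⊨K[>] φ)
    go (atom q)  w w′ z = K-bis.atoms z q
    go (neg φ)   w w′ z = ¬-cong-⇔ (go φ w w′ z)
    go (φ ∧ ψ)   w w′ z = go φ w w′ z ×-⇔ go ψ w w′ z
    go (K i φ)   w w′ z = box-cong (K-bis.forth i z) (K-bis.back i z) (go φ)
    go ([>] i φ) w w′ z = box-cong₂ ([>]-bis.forth i z) ([>]-bis.back i z) (go φ)

  -- This symmetry lets the back clause for minimal states follow from the forth clause with the
  -- models exchanged.
  flip-isK[>]Bisimulation : IsK[>]Bisimulation M M′ Z → IsK[>]Bisimulation M′ M (flip Z)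
  flip-isK[>]Bisimulation (bisK , bis[>]) =
    record
      { atoms = λ z q → ⇔-sym (K-bis.atoms z q)
      ; forth = λ i → K-bis.back i
      ; back  = λ i → K-bis.forth i
      } ,
    record
      { atoms = λ z q → ⇔-sym ([>]-bis.atoms z q)
      ; forth = λ i → [>]-bis.back i
      ; back  = λ i → [>]-bis.forth i
      }
    where
    module K-bis = IsKBisimulation bisK
    module [>]-bis = Is[>]Bisimulation bis[>]

-- Strictness contains a negated comparison, so both inclusions given by uniformity enter.
<-uniform : (M : Model G Letter ℓ) → Uniform M →
  ∀ {i w v x y} → ∼ M i w v → < M i w x y → < M i v x y
<-uniform M uniform {i} {w} {v} w∼v (x≤y , y≰x) =
  let ≤w⊆≤v , ≤v⊆≤w = uniform i w v w∼v in ≤w⊆≤v x≤y , y≰x ∘ ≤v⊆≤w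

-- `X` and `X′` are arbitrary corresponding predicates, so that the induction on formulas can insert
-- the truth sets of a condition `α` as soon as its invariance is known.
Min-forth : {M M′ : Model G Letter ℓ} {Z : REL (W M) (W M′) ℓ} →
  ExcludedMiddle ℓ → Uniform M → Uniform M′ → IsK[>]Bisimulation M M′ Z →
  {X : Pred (W M) ℓ} {X′ : Pred (W M′) ℓ} →
  (∀ u u′ → Z u u′ → u ∈ X ⇔ u′ ∈ X′) →
  ∀ i {w w′ v} → Z w w′ → v ∈ Min (≤ M i w) (X ∩ Class M i w) →
  ∃[ v′ ] Z v v′ × v′ ∈ Min (≤ M′ i w′) (X′ ∩ Class M′ i w′)
Min-forth {M = M} {M′ = M′} em uniform uniform′ (bisK , bis[>]) X⇔X′
          i {v = v} z ((v∈X , w∼v) , v-min) =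
  let v′ , zv , w′∼v′ = IsKBisimulation.forth bisK i z w∼v in
  v′ , zv , (to (X⇔X′ v v′ zv) v∈X , w′∼v′) ,
  -- Minimality asks for `v′ ≤ y′` outright; excluded middle reduces this to refuting that `y′` is
  -- strictly below `v′`.
  λ y′ (y′∈X′ , w′∼y′) y′≤v′ → decidable-stable em λ v′≰y′ →
    let y , zy , v∼y , y<ᵥv = Is[>]Bisimulation.back bis[>] i zv
          (∼′.trans (∼′.sym w′∼v′) w′∼y′)
          (<-uniform M′ uniform′ w′∼v′ (y′≤v′ , v′≰y′))
        -- The bisimulation compares in the order indexed by `v`, whereas `v-min` speaks of the one
        -- indexed by `w`.
        y≤v , v≰y = <-uniform M uniform (∼ᴹ.sym w∼v) y<ᵥv
    in v≰y (v-min y (from (X⇔X′ y y′ zy) y′∈X′ , ∼ᴹ.trans w∼v v∼y) y≤v)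
  where
  module ∼ᴹ = IsEquivalence (∼-equivalence M i)
  module ∼′ = IsEquivalence (∼-equivalence M′ i)

module _ {M M′ : Model G Letter ℓ} {Z : REL (W M) (W M′) ℓ}
         (em : ExcludedMiddle ℓ) (uniform : Uniform M) (uniform′ : Uniform M′)
         (bis : IsK[>]Bisimulation M M′ Z) where

  private
    module K-bis = IsKBisimulation (proj₁ bis)

  Min-back : {X : Pred (W M) ℓ} {X′ : Pred (W M′) ℓ} →
    (∀ u u′ → Z u u′ → u ∈ X ⇔ u′ ∈ X′) →
    ∀ i {w w′ v′} → Z w w′ → v′ ∈ Min (≤ M′ i w′) (X′ ∩ Class M′ i w′) →
    ∃[ v ] Z v v′ × v ∈ Min (≤ M i w) (X ∩ Class M i w)
  Min-back X⇔X′ i = Min-forth em uniform′ uniform (flip-isK[>]Bisimulation bis)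
    (λ u′ u z → ⇔-sym (X⇔X′ u u′ z)) i

  KBᶜ-invariance : ∀ φ w w′ → Z w w′ → (M , w ⊨KBᶜ φ) ⇔ (M′ , w′ ⊨KBᶜ φ)
  KBᶜ-invariance (atom q)  w w′ z = K-bis.atoms z q
  KBᶜ-invariance (neg φ)   w w′ z = ¬-cong-⇔ (KBᶜ-invariance φ w w′ z)
  KBᶜ-invariance (φ ∧ ψ)   w w′ z = KBᶜ-invariance φ w w′ z ×-⇔ KBᶜ-invariance ψ w w′ z
  KBᶜ-invariance (K i φ)   w w′ z =
    box-cong (K-bis.forth i z) (K-bis.back i z) (KBᶜ-invariance φ)
  -- The induction hypothesis is used twice: for `α` to match the minimal states, for `φ` to
  -- transfer the belief.
  KBᶜ-invariance (B i α φ) w w′ z = box-cong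
    (Min-forth em uniform uniform′ bis (KBᶜ-invariance α) i z)
    (Min-back (KBᶜ-invariance α) i z)
    (KBᶜ-invariance φ)

  isKBᶜBisimulation : IsKBᶜBisimulation M M′ Z
  isKBᶜBisimulation = record
    { isKBisimulation = proj₁ bis
    ; forth = λ i α → Min-forth em uniform uniform′ bis (KBᶜ-invariance α) i
    ; back  = λ i α → Min-back (KBᶜ-invariance α) i
    }

theorem24 : {g p ℓ : Level} (G : Set g) → G → (Letter : Set p) → Letter ↔ ℕ →
    (M M′ : Model G Letter ℓ) (Z : REL (W M) (W M′) ℓ) →
    (Is[>]Bisimulation M M′ Z →
    ∀ φ w w′ → Z w w′ → (M , w ⊨[>] φ) ⇔ (M′ , w′ ⊨[>] φ))
    ×
    (IsK[>]Bisimulation M M′ Z →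
    ∀ φ w w′ → Z w w′ → (M , w ⊨K[>] φ) ⇔ (M′ , w′ ⊨K[>] φ))
    ×
    (ExcludedMiddle ℓ → Uniform M → Uniform M′ → IsK[>]Bisimulation M M′ Z →
    ∀ φ w w′ → Z w w′ → (M , w ⊨KBᶜ φ) ⇔ (M′ , w′ ⊨KBᶜ φ))
    ×
    (ExcludedMiddle ℓ → Uniform M → Uniform M′ → ImageFinite M → ImageFinite M′ →
    ∀ w w′ → K[>]Bisimilar M M′ w w′ → KBᶜBisimilar M M′ w w′)
theorem24 _ _ _ _ _ _ _ =
  [>]-invariance ,
  K[>]-invariance ,
  KBᶜ-invariance ,
  -- The relation `Y` witnessing bisimilarity is itself the required bisimulation.
  λ em uniform uniform′ _ _ _ _ (Y , bis , y) →
    Y , isKBᶜBisimulation em uniform uniform′ bis , y
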